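{- Suppose that $X$ is a permutative LD-system. (1) For $x\in X$: $x\in\mathrm{Li}(X)$ if and only if $\mathrm{crit}(x)$ is the greatest element of $\mathrm{crit}[X]$. (2) $x^\sharp(\alpha)\ge\alpha$ for all $x\in X$ and $\alpha\in\mathrm{crit}[X]$. (3) $\mathrm{crit}[X]$ is a linear ordering. (4) For $x\in X$ and $\alpha\in\mathrm{crit}[X]$: $x^\sharp(\alpha)>\alpha$ if and only if $\mathrm{crit}(x)\le\alpha<\max(\mathrm{crit}[X])$. (5) For $x\in X$, $x^\sharp|_A$ is injective where $A=\{\alpha\in\mathrm{crit}[X]\mid x^\sharp(\alpha)<\max(\mathrm{crit}[X])\}$.
   Context: An LD-system is a set $X$ with a binary operation $*$ satisfying $x*(y*z)=(x*y)*(x*z)$. $\mathrm{Li}(X)$ is the set of all $x\in X$ with $x*y=y$ for all $y\in X$. A left-ideal is a subset $I$ with $y\in I\Rightarrow x*y\in I$ for all $x\in X$. The Fibonacci terms are $t_1(x,y)=y$, $t_2(x,y)=x$, $t_{n+2}(x,y)=t_{n+1}(x,y)*t_n(x,y)$. $X$ is permutative if $\mathrm{Li}(X)$ is a left-ideal and for all $x,y\in X$ there is $n\ge1$ with $t_n(x,y)\in\mathrm{Li}(X)$. In a permutative LD-system put $x^0*y=y$, $x^{n+1}*y=x*(x^n*y)$. The statement $\mathrm{crit}(x)\le\mathrm{crit}(y)$ means that $x^n*y\in\mathrm{Li}(X)$ for some $n\ge0$. This relation is reflexive and transitive, and $\mathrm{crit}(x)\le\mathrm{crit}(y)$ implies $\mathrm{crit}(r*x)\le\mathrm{crit}(r*y)$.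 $\mathrm{crit}(x)$ denotes the equivalence class of $x$ under "$\mathrm{crit}(x)\le\mathrm{crit}(y)$ and $\mathrm{crit}(y)\le\mathrm{crit}(x)$", and $\mathrm{crit}[X]=\{\mathrm{crit}(x)\mid x\in X\}$ is the resulting partially ordered set. The map $x^\sharp:\mathrm{crit}[X]\to\mathrm{crit}[X]$ is defined by $x^\sharp(\mathrm{crit}(r))=\mathrm{crit}(x*r)$; it is well defined and order preserving. -}

module Defs where

open import Algebra.Definitions using (_DistributesOverˡ_)
open import Algebra.Structures using (IsMagma)
open import Data.Nat.Base using (ℕ; zero; suc; _+_)
open import Data.Nat.Properties using (+-assoc; +-comm; +-suc)
open import Data.Product using (∃; _,_; proj₁; proj₂)
open import Level using (Level) renaming (_⊔_ to _⊔ˡ_; suc to lsuc)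
open import Relation.Binary.Bundles using (Poset)
open import Relation.Binary.Core using (Rel)
open import Relation.Binary.Definitions using (Reflexive; Transitive)
open import Relation.Binary.Morphism.Bundles using (PosetHomomorphism; mkPosetHomo)
open import Relation.Binary.PropositionalEquality using (sym; subst)
open import Relation.Unary using (Pred; _∈_)
import Relation.Binary.Construct.Interior.Symmetric as SymInterior
import Relation.Binary.Properties.Poset as PosetProperties
import Relation.Binary.Reasoning.Setoid as SetoidReasoning

-- The underlying set is a setoid, as in the library's algebraic bundles.
record LDSystem (c ℓ : Level) : Set (lsuc (c ⊔ˡ ℓ)) where
  infixl 7 _*_
  infix  4 _≈_
  field
    Carrier  : Set c
    _≈_      : Rel Carrier ℓ
    _*_      : Carrier → Carrier → Carrier
    isMagma  : IsMagma _≈_ _*_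
    selfDistribˡ : _DistributesOverˡ_ _≈_ _*_ _*_

  open IsMagma isMagma public
    using (setoid; ∙-cong; ∙-congˡ; ∙-congʳ)
    renaming (refl to ≈-refl; sym to ≈-sym; trans to ≈-trans)

  Li : Pred Carrier (c ⊔ˡ ℓ)
  Li x = ∀ y → x * y ≈ y

  LeftIdeal : ∀ {p} → Pred Carrier p → Set (c ⊔ˡ p)
  LeftIdeal I = ∀ {x y} → y ∈ I → x * y ∈ I

  -- Indices start at 0 here and at 1 on paper: t n x y is tₙ₊₁(x , y).
  t : ℕ → Carrier → Carrier → Carrier
  t zero          x y = y
  t (suc zero)    x y = x
  t (suc (suc n)) x y = t (suc n) x y * t n x y

  -- x ^ n ∙ y is x * (x * (… * (x * y))) with n occurrences of x.
  infixr 8 _^_∙_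
  _^_∙_ : Carrier → ℕ → Carrier → Carrier
  x ^ zero  ∙ y = y
  x ^ suc n ∙ y = x * (x ^ n ∙ y)

record Permutative {c ℓ} (X : LDSystem c ℓ) : Set (c ⊔ˡ ℓ) where
  open LDSystem X
  field
    Li-leftIdeal : LeftIdeal Li
    t-reaches-Li : ∀ x y → ∃ λ n → t n x y ∈ Li

module Crit {c ℓ} (X : LDSystem c ℓ) (perm : Permutative X) where
  open LDSystem X
  open Permutative perm
  open SetoidReasoning setoid

  -- crit x ≤ crit y, as a relation between x and y.
  infix 4 _≤ᶜ_
  _≤ᶜ_ : Rel Carrier (c ⊔ˡ ℓ)
  x ≤ᶜ y = ∃ λ n → x ^ n ∙ y ∈ Li

  Li-resp-≈ : ∀ {x y} → x ≈ y → x ∈ Li → y ∈ Li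
  Li-resp-≈ x≈y x∈Li z = ≈-trans (∙-congʳ (≈-sym x≈y)) (x∈Li z)

  ^-Li : ∀ x n {y} → y ∈ Li → x ^ n ∙ y ∈ Li
  ^-Li x zero    y∈Li = y∈Li
  ^-Li x (suc n) y∈Li = Li-leftIdeal (^-Li x n y∈Li)

  Li-^ : ∀ {x} n y → x ∈ Li → x ^ n ∙ y ≈ y
  Li-^ zero    y x∈Li = ≈-refl
  Li-^ (suc n) y x∈Li = ≈-trans (x∈Li _) (Li-^ n y x∈Li)

  *-^ : ∀ r x n y → r * (x ^ n ∙ y) ≈ (r * x) ^ n ∙ (r * y)
  *-^ r x zero    y = ≈-refl
  *-^ r x (suc n) y = ≈-trans (selfDistribˡ r x _) (∙-congˡ (*-^ r x n y))

  ^-distrib-* : ∀ r n x y → r ^ n ∙ (x * y) ≈ (r ^ n ∙ x) * (r ^ n ∙ y)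
  ^-distrib-* r zero    x y = ≈-refl
  ^-distrib-* r (suc n) x y =
    ≈-trans (∙-congˡ (^-distrib-* r n x y)) (selfDistribˡ r _ _)

  ^-distrib-^ : ∀ r n x m y →
                r ^ n ∙ (x ^ m ∙ y) ≈ (r ^ n ∙ x) ^ m ∙ (r ^ n ∙ y)
  ^-distrib-^ r n x zero    y = ≈-refl
  ^-distrib-^ r n x (suc m) y =
    ≈-trans (^-distrib-* r n x _) (∙-congˡ (^-distrib-^ r n x m y))

  -- Reflexivity: every product w of copies of x satisfies w * x^k∙x ≈ x^(k+1)∙x
  -- for all large k.  Taking w ∈ Li shows that x^k∙x is eventually an
  -- idempotent p; then t n p p ≈ p for all n, so p ∈ Li.
  private
    Absorbs : Carrier → Carrier → Set ℓ
    Absorbs x w = ∃ λ N → ∀ k → w * (x ^ (k + N) ∙ x) ≈ x ^ suc (k + N) ∙ x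

    absorbs-from : ∀ {x w} → (a : Absorbs x w) → ∀ k j →
                   w * (x ^ (k + (j + proj₁ a)) ∙ x) ≈ x ^ suc (k + (j + proj₁ a)) ∙ x
    absorbs-from {x} {w} (N , a) k j =
      subst (λ m → w * (x ^ m ∙ x) ≈ x ^ suc m ∙ x) (+-assoc k j N) (a (k + j))

    absorbs-* : ∀ {x u v} → Absorbs x u → Absorbs x v → Absorbs x (u * v)
    absorbs-* {x} {u} {v} (M , a) (N , b) = suc (M + N) , go
      where
      u-abs : ∀ k → u * (x ^ (k + (M + N)) ∙ x) ≈ x ^ suc (k + (M + N)) ∙ x
      u-abs k = subst (λ m → u * (x ^ (k + m) ∙ x) ≈ x ^ suc (k + m) ∙ x)
                      (+-comm N M) (absorbs-from (M , a) k N)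
      v-abs : ∀ k → v * (x ^ (k + (M + N)) ∙ x) ≈ x ^ suc (k + (M + N)) ∙ x
      v-abs k = absorbs-from (N , b) k M
      go′ : ∀ k → (u * v) * (x ^ suc (k + (M + N)) ∙ x)
                  ≈ x ^ suc (suc (k + (M + N))) ∙ x
      go′ k = begin
        (u * v) * (x ^ suc (k + (M + N)) ∙ x)    ≈⟨ ∙-congˡ (u-abs k) ⟨
        (u * v) * (u * (x ^ (k + (M + N)) ∙ x))  ≈⟨ selfDistribˡ u v _ ⟨
        u * (v * (x ^ (k + (M + N)) ∙ x))        ≈⟨ ∙-congˡ (v-abs k) ⟩
        u * (x ^ suc (k + (M + N)) ∙ x)          ≈⟨ u-abs (suc k) ⟩
        x ^ suc (suc (k + (M + N))) ∙ x          ∎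
      go : ∀ k → (u * v) * (x ^ (k + suc (M + N)) ∙ x)
                 ≈ x ^ suc (k + suc (M + N)) ∙ x
      go k = subst (λ m → (u * v) * (x ^ m ∙ x) ≈ x ^ suc m ∙ x)
                   (sym (+-suc k (M + N))) (go′ k)

    absorbs-self : ∀ x → Absorbs x x
    absorbs-self x = 0 , λ _ → ≈-refl

    absorbs-t : ∀ x n → Absorbs x (t n x x)
    absorbs-t x zero          = absorbs-self x
    absorbs-t x (suc zero)    = absorbs-self x
    absorbs-t x (suc (suc n)) = absorbs-* (absorbs-t x (suc n)) (absorbs-t x n)

    absorbs-^ : ∀ x n → Absorbs x (x ^ n ∙ x)
    absorbs-^ x zero    = absorbs-self x
    absorbs-^ x (suc n) = absorbs-* (absorbs-self x) (absorbs-^ x n)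

    t-idem : ∀ {p} → p * p ≈ p → ∀ n → t n p p ≈ p
    t-idem pp zero          = ≈-refl
    t-idem pp (suc zero)    = ≈-refl
    t-idem pp (suc (suc n)) =
      ≈-trans (∙-cong (t-idem pp (suc n)) (t-idem pp n)) pp

  ≤ᶜ-refl : Reflexive _≤ᶜ_
  ≤ᶜ-refl {x} = N , Li-resp-≈ (t-idem p-idem (proj₁ r)) (proj₂ r)
    where
    w = t-reaches-Li x x
    N = proj₁ (absorbs-t x (proj₁ w))
    p = x ^ N ∙ x
    r = t-reaches-Li p p

    step : ∀ k → x ^ suc (k + N) ∙ x ≈ x ^ (k + N) ∙ x
    step k = ≈-trans (≈-sym (proj₂ (absorbs-t x (proj₁ w)) k)) (proj₂ w _)

    stable : ∀ k → x ^ (k + N) ∙ x ≈ p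
    stable zero    = ≈-refl
    stable (suc k) = ≈-trans (step k) (stable k)

    a = absorbs-^ x N
    M = proj₁ a

    stable-M : x ^ (N + M) ∙ x ≈ p
    stable-M = subst (λ m → x ^ m ∙ x ≈ p) (+-comm M N) (stable M)

    p-idem : p * p ≈ p
    p-idem = begin
      p * p                    ≈⟨ ∙-congˡ stable-M ⟨
      p * (x ^ (N + M) ∙ x)    ≈⟨ proj₂ a N ⟩
      x * (x ^ (N + M) ∙ x)    ≈⟨ ∙-congˡ stable-M ⟩
      x * p                    ≈⟨ step 0 ⟩
      p                        ∎

  ≤ᶜ-trans : Transitive _≤ᶜ_
  ≤ᶜ-trans {x} {y} {z} (n , xy) (m , yz) = n , Li-resp-≈ eq (^-Li x n yz)
    where
    eq : x ^ n ∙ (y ^ m ∙ z) ≈ x ^ n ∙ z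
    eq = ≈-trans (^-distrib-^ x n y m z) (Li-^ m _ xy)

  *-mono-≤ᶜ : ∀ r {x y} → x ≤ᶜ y → r * x ≤ᶜ r * y
  *-mono-≤ᶜ r {x} {y} (n , xy) = n , Li-resp-≈ (*-^ r x n y) (Li-leftIdeal xy)

  -- The quotient of Carrier by mutual ≤ᶜ: its elements are represented by
  -- elements of Carrier, and its equality _≈_ is the symmetric interior of ≤ᶜ.
  crit[X] : Poset c (c ⊔ˡ ℓ) (c ⊔ˡ ℓ)
  crit[X] = SymInterior.poset {R = _≤ᶜ_} ≤ᶜ-refl ≤ᶜ-trans

  crit : Carrier → Poset.Carrier crit[X]
  crit x = x

  infix 9 _♯
  _♯ : Carrier → PosetHomomorphism crit[X] crit[X]
  x ♯ = mkPosetHomo crit[X] crit[X] (x *_) (*-mono-≤ᶜ x)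

module CritOrder {c ℓ} (X : LDSystem c ℓ) (perm : Permutative X) where
  open LDSystem X public using (Carrier; Li)
  open Crit X perm public using (crit[X]; crit; _♯)
  open Poset crit[X] public using (_≈_; _≤_) renaming (Carrier to ∣crit[X]∣)
  open PosetProperties crit[X] public using (_<_)
  open PosetHomomorphism public using (⟦_⟧)

{-# OPTIONS --safe #-}
-- Everything rests on two remarks.  Since rⁿ * (x * r) = (rⁿ * x) * (rⁿ * r), reflexivity
-- of ≤ᶜ gives crit r ≤ crit (x * r).  Since tₙ₊₁(x , y) = tₙ(x * y , x), induction on n
-- then makes ≤ᶜ total: comparing x * y with x decides between crit y ≤ crit (x * y) ≤ crit x
-- and crit x ≤ crit (x * y), the latter being crit x ≤ crit y.  The same comparison shows
-- that crit (x * y) = crit y unless crit x ≤ crit y, whence (4) and (5).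
module Submission where

open import Defs
open import Data.Empty using (⊥-elim)
open import Data.Nat.Base using (zero; suc)
open import Data.Product using (∃; _×_; _,_)
open import Data.Sum.Base using (_⊎_; inj₁; inj₂)
open import Function.Bundles using (_⇔_; mk⇔)
open import Relation.Binary.Bundles using (Poset)
open import Relation.Binary.Construct.Interior.Symmetric using (_,_)
open import Relation.Binary.Definitions using (Maximum; Total)
open import Relation.Binary.PropositionalEquality using (_≡_; refl; cong₂; subst)
open import Relation.Binary.Structures using (IsTotalOrder)
open import Relation.Unary using (_∈_)

module _ {c ℓ} (X : LDSystem c ℓ) where
  open LDSystem X

  ^-congʳ : ∀ x n {y z} → y ≈ z → x ^ n ∙ y ≈ x ^ n ∙ z
  ^-congʳ x zero    y≈z = y≈z
  ^-congʳ x (suc n) y≈z = ∙-congˡ (^-congʳ x n y≈z)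

  ^-*-comm : ∀ x n y → x ^ n ∙ (x * y) ≡ x ^ suc n ∙ y
  ^-*-comm x zero    y = refl
  ^-*-comm x (suc n) y = cong₂ _*_ refl (^-*-comm x n y)

  -- Restarting the sequence at its second entry turns the two-step recursion of `t` into a one-step
  -- induction with changed arguments.
  t-shift : ∀ n x y → t (suc n) x y ≡ t n (x * y) x
  t-shift zero          x y = refl
  t-shift (suc zero)    x y = refl
  t-shift (suc (suc n)) x y = cong₂ _*_ (t-shift (suc n) x y) (t-shift n x y)

module CritProperties {c ℓ} (X : LDSystem c ℓ) (perm : Permutative X) where
  open LDSystem X
  open Permutative perm
  open Crit X perm
  open CritOrder X perm using (_<_)

  ≤ᶜ-respʳ-≈ : ∀ {x y z} → y ≈ z → x ≤ᶜ y → x ≤ᶜ z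
  ≤ᶜ-respʳ-≈ {x} y≈z (n , p) = n , Li-resp-≈ (^-congʳ X x n y≈z) p

  Li⇒maximum : ∀ {x} → x ∈ Li → Maximum _≤ᶜ_ x
  Li⇒maximum x∈Li y = 0 , x∈Li

  Li-nonempty : Carrier → ∃ Li
  Li-nonempty x with n , p ← t-reaches-Li x x = t n x x , p

  -- A single comparison suffices: some `e ∈ Li` lies below `x`, and powers of `e` act as the
  -- identity.
  maximum⇒Li : ∀ {x} → Maximum _≤ᶜ_ x → x ∈ Li
  maximum⇒Li {x} x-max with e , e∈Li ← Li-nonempty x with n , p ← x-max e =
    Li-resp-≈ (Li-^ n x e∈Li) p

  maximum-upward : ∀ {x y} → Maximum _≤ᶜ_ x → x ≤ᶜ y → Maximum _≤ᶜ_ y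
  maximum-upward x-max x≤y z = ≤ᶜ-trans (x-max z) x≤y

  *-inflationary : ∀ x r → r ≤ᶜ x * r
  *-inflationary x r with n , p ← ≤ᶜ-refl {r} =
    n , Li-resp-≈ (≈-sym (^-distrib-* r n x r)) (Li-leftIdeal p)

  ^-inflationary : ∀ x n r → r ≤ᶜ x ^ n ∙ r
  ^-inflationary x zero    r = ≤ᶜ-refl
  ^-inflationary x (suc n) r = ≤ᶜ-trans (^-inflationary x n r) (*-inflationary x _)

  -- Serves to force maximality: once `x ^ n ∙ r` is in `Li`, so is everything above it.
  ^-deflationary : ∀ {x r} → x * r ≤ᶜ r → ∀ n → x ^ n ∙ r ≤ᶜ r
  ^-deflationary xr≤r zero    = ≤ᶜ-refl
  ^-deflationary {x} xr≤r (suc n) =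
    ≤ᶜ-trans (*-mono-≤ᶜ x (^-deflationary xr≤r n)) xr≤r

  -- The extra factor `x` is absorbed into the exponent that witnesses `≤ᶜ`.
  ≤ᶜ-*-cancel : ∀ {x y} → x ≤ᶜ x * y → x ≤ᶜ y
  ≤ᶜ-*-cancel {x} {y} (n , p) = suc n , subst Li (^-*-comm X x n y) p

  ≤ᶜ-^-cancel : ∀ {x y} n → x ≤ᶜ x ^ n ∙ y → x ≤ᶜ y
  ≤ᶜ-^-cancel zero    p = p
  ≤ᶜ-^-cancel (suc n) p = ≤ᶜ-^-cancel n (≤ᶜ-*-cancel p)

  t∈Li⇒comparable : ∀ n {x y} → t n x y ∈ Li → x ≤ᶜ y ⊎ y ≤ᶜ x
  t∈Li⇒comparable zero    p = inj₁ (0 , p)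
  t∈Li⇒comparable (suc n) {x} {y} p
    with t∈Li⇒comparable n (subst Li (t-shift X n x y) p)
  ... | inj₁ xy≤x = inj₂ (≤ᶜ-trans (*-inflationary x y) xy≤x)
  ... | inj₂ x≤xy = inj₁ (≤ᶜ-*-cancel x≤xy)

  ≤ᶜ-total : Total _≤ᶜ_
  ≤ᶜ-total x y with n , p ← t-reaches-Li x y = t∈Li⇒comparable n p

  -- If w = x * r satisfies wᵏ * x ∈ Li, then wᵏ * w = (wᵏ * x) * (wᵏ * r) = wᵏ * r.
  *-deflationary-or-≤ᶜ : ∀ x r → x * r ≤ᶜ r ⊎ x ≤ᶜ r
  *-deflationary-or-≤ᶜ x r with ≤ᶜ-total (x * r) x
  ... | inj₂ x≤w = inj₂ (≤ᶜ-*-cancel x≤w)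
  -- Inflation gives `w ≤ᶜ w ^ k ∙ w ≈ w ^ k ∙ r`, and the powers of `w` cancel.
  ... | inj₁ (k , p) = inj₁ (≤ᶜ-^-cancel k (≤ᶜ-respʳ-≈ wᵏw≈wᵏr (^-inflationary w k w)))
    where
    w = x * r
    wᵏw≈wᵏr : w ^ k ∙ w ≈ w ^ k ∙ r
    wᵏw≈wᵏr = ≈-trans (^-distrib-* w k x r) (p _)

  -- The hypothesis puts `x * (s ^ n ∙ r)` in `Li`. If `s * r ≤ᶜ r`, this element lies below
  -- `x * r`, making `x * r` maximal; so the dichotomy for `s` and `r` leaves `s ≤ᶜ r`.
  *-cancel-≤ᶜ : ∀ {μ x r s} → Maximum _≤ᶜ_ μ → x * r < μ → x * s ≤ᶜ x * r → s ≤ᶜ r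
  *-cancel-≤ᶜ {μ} {x} {r} {s} μ-max (xr≤μ , xr≉μ) (n , p) with *-deflationary-or-≤ᶜ s r
  ... | inj₂ s≤r  = s≤r
  ... | inj₁ sr≤r = ⊥-elim (xr≉μ (xr≤μ , μ≤xr))
    where
    x*sⁿr∈Li : x * (s ^ n ∙ r) ∈ Li
    x*sⁿr∈Li = Li-resp-≈ (≈-sym (*-^ x s n r)) p
    μ≤xr : μ ≤ᶜ x * r
    μ≤xr = ≤ᶜ-trans (Li⇒maximum x*sⁿr∈Li μ) (*-mono-≤ᶜ x (^-deflationary sr≤r n))

  <-*⇒≤ᶜ : ∀ {x r} → r < x * r → x ≤ᶜ r
  <-*⇒≤ᶜ {x} {r} (r≤xr , r≉xr) with *-deflationary-or-≤ᶜ x r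
  ... | inj₁ xr≤r = ⊥-elim (r≉xr (r≤xr , xr≤r))
  ... | inj₂ x≤r  = x≤r

  <⇒<-maximum : ∀ {μ r s} → Maximum _≤ᶜ_ μ → r < s → r < μ
  <⇒<-maximum {s = s} μ-max (r≤s , r≉s) =
    μ-max _ , λ (_ , μ≤r) → r≉s (r≤s , maximum-upward μ-max μ≤r s)

  -- Were `x * r ≤ᶜ r`, then `x ^ n ∙ r ∈ Li` would lie below `r`, making `r` maximal.
  ≤ᶜ∧<-maximum⇒<-* : ∀ {μ x r} → x ≤ᶜ r → r < μ → r < x * r
  ≤ᶜ∧<-maximum⇒<-* {μ} {x} {r} (n , p) (r≤μ , r≉μ) =
    *-inflationary x r ,
    λ (_ , xr≤r) → r≉μ (r≤μ , maximum-upward (Li⇒maximum p) (^-deflationary xr≤r n) μ)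

theorem2p21 : ∀ {c ℓ} (X : LDSystem c ℓ) (perm : Permutative X) →
  let open CritOrder X perm in
    -- (1)
    (∀ (x : Carrier) → x ∈ Li ⇔ Maximum _≤_ (crit x))
    -- (2)
  × (∀ (x : Carrier) (α : ∣crit[X]∣) → α ≤ ⟦ x ♯ ⟧ α)
    -- (3)
  × IsTotalOrder _≈_ _≤_
    -- max(crit[X]) exists as soon as X has an element
  × (Carrier → ∃ λ (μ : ∣crit[X]∣) → Maximum _≤_ μ)
    -- (4), (5): μ is max(crit[X])
  × (∀ (μ : ∣crit[X]∣) → Maximum _≤_ μ →
        (∀ (x : Carrier) (α : ∣crit[X]∣) →
           α < ⟦ x ♯ ⟧ α ⇔ (crit x ≤ α × α < μ))
      × (∀ (x : Carrier) (α β : ∣crit[X]∣) →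
           ⟦ x ♯ ⟧ α < μ → ⟦ x ♯ ⟧ β < μ →
           ⟦ x ♯ ⟧ α ≈ ⟦ x ♯ ⟧ β → α ≈ β))
theorem2p21 X perm =
    (λ x → mk⇔ Li⇒maximum maximum⇒Li)
  , *-inflationary
  , record { isPartialOrder = Poset.isPartialOrder crit[X] ; total = ≤ᶜ-total }
  , (λ x → let e , e∈Li = Li-nonempty x in e , Li⇒maximum e∈Li)
  , λ μ μ-max →
      (λ x α → mk⇔ (λ α<xα → <-*⇒≤ᶜ α<xα , <⇒<-maximum μ-max α<xα)
                   (λ (x≤α , α<μ) → ≤ᶜ∧<-maximum⇒<-* x≤α α<μ))
    -- Each half of `≈` is cancelled using the strict bound on its right-hand side.
    , (λ x α β xα<μ xβ<μ (xα≤xβ , xβ≤xα) →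
         *-cancel-≤ᶜ μ-max xβ<μ xα≤xβ , *-cancel-≤ᶜ μ-max xα<μ xβ≤xα)
  where
  open Crit X perm using (crit[X])
  open CritProperties X perm
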